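{- Let $(\mathbb{S},\oplus,\otimes,\mathbb{0},\mathbb{1},\leq_{\mathbb{S}})$ be a totally ordered idempotent semiring and let $\mathcal{P}\subset\mathbb{S}^n$ be the solution set of the system $A\mathbf{x}\oplus\mathbf{c}\leq_{\mathbb{S}}B\mathbf{x}\oplus\mathbf{d}$, where $A,B\in\mathbb{S}^{p\times n}$ and $\mathbf{c},\mathbf{d}\in\mathbb{S}^p$ satisfy the following conditions: (i) $A_{in}$ is (left-)invertible with respect to $\otimes$ if $A_{in}\neq\mathbb{0}$ (its inverse is denoted by $A_{in}^{ -1}$); (ii) for any $\alpha\in\mathbb{S}$ there exists $\beta\in\mathbb{S}$ such that $\alpha\leq_{\mathbb{S}}B_{in}\beta$ if $B_{in}\neq\mathbb{0}$; (iii) either $A_{ij}=\mathbb{0}$ or $B_{ij}=\mathbb{0}$, for $i\in\{1,\dots,p\}$ and $j\in\{1,\dots,n\}$. Let $\mathcal{Q}\subset\mathbb{S}^{n-1}$ be the set defined by the following inequalities in the variables $\mathbf{x}_1,\dots,\mathbf{x}_{n-1}$: $$\Big(\bigoplus_{j\neq n}A_{ij}\mathbf{x}_j\Big)\oplus\mathbf{c}_i\leq_{\mathbb{S}}\Big(\bigoplus_{j\neq n}B_{ij}\mathbf{x}_j\Big)\oplus\mathbf{d}_i$$ for all $i\in\{1,\dots,p\}$ such that $B_{in}=\mathbb{0}$, and $$\Big(\bigoplus_{j\neq n}A_{ij}\mathbf{x}_j\Big)\oplus\mathbf{c}_i\leq_{\mathbb{S}}\Big(\bigoplus_{j\neq n}(B_{ij}\oplus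 B_{in}A_{kn}^{ -1}B_{kj})\mathbf{x}_j\Big)\oplus\mathbf{d}_i\oplus B_{in}A_{kn}^{ -1}\mathbf{d}_k$$ for all $i,k\in\{1,\dots,p\}$ such that $B_{in}\neq\mathbb{0}$ and $A_{kn}\neq\mathbb{0}$. Then $\mathbf{x}\in\mathcal{Q}$ if, and only if, there exists $\lambda\in\mathbb{S}$ such that $(\mathbf{x},\lambda)\in\mathcal{P}$.
   Context: A semiring $(\mathbb{S},\oplus,\otimes,\mathbb{0},\mathbb{1})$ (multiplication $\otimes$ is also written as concatenation) is totally ordered if there is a total order $\leq_{\mathbb{S}}$ on $\mathbb{S}$ such that $\mathbb{0}\leq_{\mathbb{S}}a$ for all $a\in\mathbb{S}$, and for all $a,b,c\in\mathbb{S}$, $a\leq_{\mathbb{S}}b$ implies $a\oplus c\leq_{\mathbb{S}}b\oplus c$, $a\otimes c\leq_{\mathbb{S}}b\otimes c$ and $c\otimes a\leq_{\mathbb{S}}c\otimes b$. It is idempotent if $a\oplus a=a$ for all $a\in\mathbb{S}$. An element $a$ is left-invertible if there is an element $a^{ -1}\in\mathbb{S}$ with $a^{ -1}\otimes a=\mathbb{1}$. Here $M_{in}$ denotes the $(i,n)$-entry of a matrix $M$ (with $n$ the index of the eliminated variable $\mathbf{x}_n$). Matrix-vector operations are the usual ones with $\oplus,\otimes$ (so $(A\mathbf{x})_i=\bigoplus_jA_{ij}\otimes\mathbf{x}_j$), and vector inequalities are entrywise.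
   Formalization: In (i) each nonzero A_in must have a two-sided inverse; with only a left inverse the claim fails (e.g. aλ ≤ 1, b ≤ λ in an ordered bicyclic monoid with zero, ba = 1 < ab). The total order and equality are assumed decidable, which is automatic classically. -}

module Defs where

open import Algebra.Core using (Op₂)
open import Algebra.Bundles using (IdempotentSemiring)
open import Algebra.Definitions using (Invertible)
open import Algebra.Structures using (IsIdempotentSemiring)
open import Data.Fin.Base using (Fin; fromℕ)
open import Data.Nat.Base using (ℕ; suc)
open import Data.Product.Base using (_×_; proj₁)
open import Data.Vec.Functional using (Vector; zipWith; removeAt)
open import Data.Vec.Functional.Relation.Binary.Pointwise using (Pointwise)
open import Level using (_⊔_) renaming (suc to lsuc)
open import Relation.Binary.Core using (Rel)
open import Relation.Binary.Definitions using (Minimum; LeftMonotonic; RightMonotonic)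
open import Relation.Binary.Structures using (IsDecTotalOrder)
open import Relation.Unary using (Pred)

-- The order is decidable because results over these semirings split on
-- whether an entry is 0#; classically every total order is decidable.
record IsTotallyOrderedIdempotentSemiring
  {a ℓ₁ ℓ₂} {A : Set a} (_≈_ : Rel A ℓ₁) (_≤_ : Rel A ℓ₂)
  (_+_ _*_ : Op₂ A) (0# 1# : A) : Set (a ⊔ ℓ₁ ⊔ ℓ₂) where
  field
    isIdempotentSemiring : IsIdempotentSemiring _≈_ _+_ _*_ 0# 1#
    isDecTotalOrder      : IsDecTotalOrder _≈_ _≤_
    0#-minimum           : Minimum _≤_ 0#
    +-monoˡ-≤            : RightMonotonic _≤_ _≤_ _+_
    *-monoˡ-≤            : RightMonotonic _≤_ _≤_ _*_
    *-monoʳ-≤            : LeftMonotonic _≤_ _≤_ _*_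

record TotallyOrderedIdempotentSemiring c ℓ₁ ℓ₂ : Set (lsuc (c ⊔ ℓ₁ ⊔ ℓ₂)) where
  infixl 7 _*_
  infixl 6 _+_
  infix  4 _≈_ _≤_
  field
    Carrier : Set c
    _≈_     : Rel Carrier ℓ₁
    _≤_     : Rel Carrier ℓ₂
    _+_     : Op₂ Carrier
    _*_     : Op₂ Carrier
    0#      : Carrier
    1#      : Carrier
    isTotallyOrderedIdempotentSemiring :
      IsTotallyOrderedIdempotentSemiring _≈_ _≤_ _+_ _*_ 0# 1#

  open IsTotallyOrderedIdempotentSemiring isTotallyOrderedIdempotentSemiring public

  idempotentSemiring : IdempotentSemiring c ℓ₁
  idempotentSemiring = record { isIdempotentSemiring = isIdempotentSemiring }

  open IdempotentSemiring idempotentSemiring public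
    using (_≉_; semiring)

module _ {c ℓ₁ ℓ₂} (S : TotallyOrderedIdempotentSemiring c ℓ₁ ℓ₂) where

  open TotallyOrderedIdempotentSemiring S
  open import Algebra.Properties.Semiring.Sum semiring using (sum)

  Matrix : ℕ → ℕ → Set c
  Matrix p n = Vector (Vector Carrier n) p

  dot : ∀ {n} → Vector Carrier n → Vector Carrier n → Carrier
  dot u x = sum (zipWith _*_ u x)

  mulVec : ∀ {p n} → Matrix p n → Vector Carrier n → Vector Carrier p
  mulVec A x i = dot (A i) x

  SolutionSet : ∀ {p n} (A B : Matrix p n) (c d : Vector Carrier p) →
                Pred (Vector Carrier n) ℓ₂
  SolutionSet A B c d x =
    Pointwise _≤_ (zipWith _+_ (mulVec A x) c) (zipWith _+_ (mulVec B x) d)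

  module _ {p m : ℕ} (A : Matrix p (suc m)) where

    -- Two-sided: elimination fails if only a⁻¹ * a ≈ 1# is required. If
    -- b * a ≈ 1# but a * b ≰ 1# (as can happen in the bicyclic monoid with a
    -- zero adjoined, under a suitable total order), then a * μ ≤ 1#, b ≤ μ has
    -- no solution μ, while eliminating μ leaves the true inequality b ≤ b * 1#.
    LastColumnInvertible : Set (c ⊔ ℓ₁)
    LastColumnInvertible =
      ∀ k → A k (fromℕ m) ≉ 0# → Invertible _≈_ 1# _*_ (A k (fromℕ m))

    -- The inverse is taken from the invertibility hypothesis; being two-sided,
    -- it does not depend, up to _≈_, on the witness chosen.
    EliminatedSet : (B : Matrix p (suc m)) (c d : Vector Carrier p) →
                    LastColumnInvertible → Pred (Vector Carrier m) (ℓ₁ ⊔ ℓ₂)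
    EliminatedSet B c d inv x =
      (∀ i → B i n ≈ 0# →
         dot (removeAt (A i) n) x + c i ≤ dot (removeAt (B i) n) x + d i)
      ×
      (∀ i k → B i n ≉ 0# → (Akn≉0 : A k n ≉ 0#) →
         let A⁻¹ = proj₁ (inv k Akn≉0) in
         dot (removeAt (A i) n) x + c i
           ≤ dot (removeAt (λ j → B i j + B i n * A⁻¹ * B k j) n) x
               + d i + B i n * A⁻¹ * d k)
      where
      n : Fin (suc m)
      n = fromℕ m

{-# OPTIONS --safe #-}

-- Write row i of the system, with λ in place of the last variable, as
-- u i + a i * λ ≤ v i + b i * λ, where a and b are the last columns of A and B.
-- Since + is the maximum and a i or b i vanishes, it says that u i ≤ v i + b i * λ
-- and, when a i ≠ 0, that λ ≤ (a i)⁻¹ * v i. Hence the best choice of λ is the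
-- minimum of these upper bounds; it is attained at some k, and for it the
-- remaining conditions are the eliminated inequalities. When all a i vanish,
-- condition (ii) allows λ to be taken large enough.
module Submission where

open import Defs
open import Algebra.Bundles using (Semiring)
open import Algebra.Definitions using (Invertible)
open import Algebra.Structures using (IsIdempotentSemiring)
open import Data.Fin.Base using (Fin; zero; suc; fromℕ)
open import Data.Nat.Base using (ℕ; zero; suc)
open import Data.Product.Base using (∃-syntax; _×_; _,_; proj₁; proj₂)
open import Data.Sum.Base using (_⊎_; inj₁; inj₂)
open import Data.Vec.Functional using (Vector; insertAt; removeAt; zipWith)
open import Data.Vec.Functional.Properties using (insertAt-lookup; insertAt-punchIn)
open import Function.Base using (_∘_)
open import Function.Bundles using (_⇔_; mk⇔)
open import Relation.Binary.Bundles using (Poset)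
open import Relation.Binary.Structures using (IsDecTotalOrder)
open import Relation.Nullary.Decidable.Core using (yes; no)
open import Relation.Nullary.Negation.Core using (¬_; contradiction)
open import Relation.Unary using (Decidable)

module _ {c ℓ₁ ℓ₂} (S : TotallyOrderedIdempotentSemiring c ℓ₁ ℓ₂) where

  open TotallyOrderedIdempotentSemiring S
  open IsDecTotalOrder isDecTotalOrder
    using (_≟_; total; isPartialOrder; ≤-respˡ-≈; ≤-respʳ-≈)
    renaming (refl to ≤-refl; trans to ≤-trans)
  open Semiring semiring
    using ( reflexive; sym; trans; +-cong; +-congˡ; *-congˡ; *-congʳ; *-assoc
          ; +-comm; +-identityˡ; +-identityʳ; *-identityˡ; zeroˡ; distribʳ)
  open IsIdempotentSemiring isIdempotentSemiring using (+-idem)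
  open import Algebra.Properties.Semiring.Sum semiring
    using (sum; sum-remove; sum-cong-≋; ∑-distrib-+; *-distribˡ-sum)

  private
    poset : Poset c ℓ₁ ℓ₂
    poset = record { isPartialOrder = isPartialOrder }

  open import Relation.Binary.Reasoning.PartialOrder poset

  x≤x+y : ∀ x y → x ≤ x + y
  x≤x+y x y = begin
    x       ≈⟨ +-identityˡ x ⟨
    0# + x  ≤⟨ +-monoˡ-≤ x (0#-minimum y) ⟩
    y + x   ≈⟨ +-comm y x ⟩
    x + y   ∎

  y≤x+y : ∀ x y → y ≤ x + y
  y≤x+y x y = ≤-respʳ-≈ (+-comm y x) (x≤x+y y x)

  -- Monotonicity replaces both summands by `z`, and idempotence collapses `z + z`. Together with
  -- `x≤x+y` and `y≤x+y` this makes `+` the join, hence the maximum, as the order is total.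
  +-lub : ∀ {x y z} → x ≤ z → y ≤ z → x + y ≤ z
  +-lub {x} {y} {z} x≤z y≤z = begin
    x + y  ≤⟨ +-monoˡ-≤ y x≤z ⟩
    z + y  ≈⟨ +-comm z y ⟩
    y + z  ≤⟨ +-monoˡ-≤ z y≤z ⟩
    z + z  ≈⟨ +-idem z ⟩
    z      ∎

  +-monoʳ-≤ : ∀ x {y z} → y ≤ z → x + y ≤ x + z
  +-monoʳ-≤ x y≤z = +-lub (x≤x+y x _) (≤-trans y≤z (y≤x+y x _))

  x≈0⇒y+xz≈y : ∀ {x} y z → x ≈ 0# → y + x * z ≈ y
  x≈0⇒y+xz≈y y z x≈0 =
    trans (+-congˡ (trans (*-congʳ x≈0) (zeroˡ z))) (+-identityʳ y)

  lookup≤sum : ∀ {n} (t : Vector Carrier n) i → t i ≤ sum t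
  lookup≤sum t zero    = x≤x+y _ _
  lookup≤sum t (suc i) = ≤-trans (lookup≤sum (t ∘ suc) i) (y≤x+y _ _)

  dot-insertAt : ∀ {n} (u : Vector Carrier (suc n)) x i μ →
                 dot S u (insertAt x i μ) ≈ dot S (removeAt u i) x + u i * μ
  dot-insertAt u x i μ = begin-equality
    sum t                       ≈⟨ sum-remove {i = i} t ⟩
    t i + sum (removeAt t i)    ≈⟨ +-comm _ _ ⟩
    sum (removeAt t i) + t i    ≈⟨ +-cong
      (sum-cong-≋ λ j → *-congˡ (reflexive (insertAt-punchIn x i μ j)))
      (*-congˡ (reflexive (insertAt-lookup x i μ))) ⟩
    dot S (removeAt u i) x + u i * μ ∎
    where
    t : Vector Carrier _
    t = zipWith _*_ u (insertAt x i μ)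

  -- Serves to split the coefficients of an eliminated inequality into row `i` of `B` and a multiple
  -- of row `k`. The factor `t` stays on the left because multiplication need not commute.
  dot-+-* : ∀ {n} (u v x : Vector Carrier n) t →
            dot S (λ j → u j + t * v j) x ≈ dot S u x + t * dot S v x
  dot-+-* u v x t = begin-equality
    sum (λ j → (u j + t * v j) * x j)
      ≈⟨ sum-cong-≋ (λ j → trans (distribʳ (x j) (u j) (t * v j))
                                 (+-congˡ (*-assoc t (v j) (x j)))) ⟩
    sum (λ j → u j * x j + t * (v j * x j))
      ≈⟨ ∑-distrib-+ (λ j → u j * x j) _ ⟩
    dot S u x + sum (λ j → t * (v j * x j))
      ≈⟨ +-congˡ (*-distribˡ-sum t (zipWith _*_ v x)) ⟨
    dot S u x + t * dot S v x ∎

  -- f may depend on the proof of ¬ Q k because any two such proofs are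
  -- definitionally equal.
  argmin : ∀ {p q} {Q : Fin p → Set q} → Decidable Q →
           (f : ∀ k → ¬ Q k → Carrier) →
           (∀ k → Q k) ⊎ (∃[ k ] ∃[ ¬q ] (∀ j ¬r → f k ¬q ≤ f j ¬r))
  argmin {zero} Q? f = inj₁ λ ()
  argmin {suc p} Q? f with Q? zero | argmin (Q? ∘ suc) (f ∘ suc)
  ... | yes q | inj₁ qs = inj₁ λ { zero → q ; (suc k) → qs k }
  ... | yes q | inj₂ (k , ¬q , min) = inj₂ (suc k , ¬q , λ
    { zero    ¬r → contradiction q ¬r
    ; (suc j) ¬r → min j ¬r })
  ... | no ¬q | inj₁ qs = inj₂ (zero , ¬q , λ
    { zero    ¬r → ≤-refl
    ; (suc j) ¬r → contradiction (qs j) ¬r })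
  ... | no ¬q | inj₂ (k , ¬q′ , min) with total (f zero ¬q) (f (suc k) ¬q′)
  ...   | inj₁ f₀≤fₖ = inj₂ (zero , ¬q , λ
    { zero    ¬r → ≤-refl
    ; (suc j) ¬r → ≤-trans f₀≤fₖ (min j ¬r) })
  ...   | inj₂ fₖ≤f₀ = inj₂ (suc k , ¬q′ , λ
    { zero    ¬r → fₖ≤f₀
    ; (suc j) ¬r → min j ¬r })

  module _ {p : ℕ} (a b u v : Vector Carrier p)
           (inv : ∀ k → a k ≉ 0# → Invertible _≈_ 1# _*_ (a k)) where

    Solution : Carrier → Set ℓ₂
    Solution μ = ∀ i → u i + a i * μ ≤ v i + b i * μ

    -- The second family is row `i` with the unknown replaced by `a⁻¹ * v k`, the bound that row `k`
    -- puts on it, and with the term in `a i` dropped.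
    Eliminated : Set _
    Eliminated =
      (∀ i → b i ≈ 0# → u i ≤ v i) ×
      (∀ i k → b i ≉ 0# → (aₖ≉0 : a k ≉ 0#) →
        u i ≤ v i + b i * proj₁ (inv k aₖ≉0) * v k)

    module _ (disjoint : ∀ i → a i ≈ 0# ⊎ b i ≈ 0#) where

      a≉0⇒b≈0 : ∀ {i} → a i ≉ 0# → b i ≈ 0#
      a≉0⇒b≈0 {i} aᵢ≉0 with disjoint i
      ... | inj₁ aᵢ≈0 = contradiction aᵢ≈0 aᵢ≉0
      ... | inj₂ bᵢ≈0 = bᵢ≈0

      -- If `a k` is nonzero, the unknown disappears from the right side of row `k`, which then
      -- bounds `a k * μ` by `v k`. Writing `μ` in row `i` as `a⁻¹ * (a k * μ)`, by the left inverse
      -- law, lets this bound be inserted.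
      solution⇒eliminated : ∀ {μ} → Solution μ → Eliminated
      solution⇒eliminated {μ} sol = upper , λ i k _ aₖ≉0 →
        let a⁻¹ , a⁻¹a≈1 , _ = inv k aₖ≉0 in begin
        u i                            ≤⟨ x≤x+y _ _ ⟩
        u i + a i * μ                  ≤⟨ sol i ⟩
        v i + b i * μ                  ≈⟨ +-congˡ (*-congˡ (*-identityˡ μ)) ⟨
        v i + b i * (1# * μ)           ≈⟨ +-congˡ (*-congˡ (*-congʳ a⁻¹a≈1)) ⟨
        v i + b i * (a⁻¹ * a k * μ)    ≈⟨ +-congˡ (*-congˡ (*-assoc a⁻¹ (a k) μ)) ⟩
        v i + b i * (a⁻¹ * (a k * μ))  ≈⟨ +-congˡ (*-assoc (b i) a⁻¹ _) ⟨
        v i + b i * a⁻¹ * (a k * μ)    ≤⟨ +-monoʳ-≤ _ (*-monoʳ-≤ _ (aμ≤v k aₖ≉0)) ⟩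
        v i + b i * a⁻¹ * v k          ∎
        where
        upper : ∀ i → b i ≈ 0# → u i ≤ v i
        upper i bᵢ≈0 =
          ≤-trans (x≤x+y _ _) (≤-respʳ-≈ (x≈0⇒y+xz≈y _ _ bᵢ≈0) (sol i))
        aμ≤v : ∀ k → a k ≉ 0# → a k * μ ≤ v k
        aμ≤v k aₖ≉0 =
          ≤-trans (y≤x+y _ _) (≤-respʳ-≈ (x≈0⇒y+xz≈y _ _ (a≉0⇒b≈0 aₖ≉0)) (sol k))

      module _ (unbounded : ∀ i → b i ≉ 0# → ∀ α → ∃[ β ] (α ≤ b i * β))
               (elim : Eliminated) where

        bound : ∀ k → a k ≉ 0# → Carrier
        bound k aₖ≉0 = proj₁ (inv k aₖ≉0) * v k

        -- By the right inverse law, `a k * μ ≤ v k` becomes an equality at the bound, so by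
        -- monotonicity it holds for every `μ` below the bound.
        a*bound≈v : ∀ k aₖ≉0 → a k * bound k aₖ≉0 ≈ v k
        a*bound≈v k aₖ≉0 with inv k aₖ≉0
        ... | a⁻¹ , _ , aa⁻¹≈1 = begin-equality
          a k * (a⁻¹ * v k)  ≈⟨ *-assoc (a k) a⁻¹ (v k) ⟨
          a k * a⁻¹ * v k    ≈⟨ *-congʳ aa⁻¹≈1 ⟩
          1# * v k           ≈⟨ *-identityˡ (v k) ⟩
          v k                ∎

        witness : ∀ i → ∃[ β ] (b i ≉ 0# → u i ≤ b i * β)
        witness i with b i ≟ 0#
        -- Here `0#` is a placeholder, since the implication is vacuous. It gives every row a
        -- witness, so that the witnesses can be summed.
        ... | yes bᵢ≈0 = 0# , contradiction bᵢ≈0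
        ... | no  bᵢ≉0 = let β , u≤bβ = unbounded i bᵢ≉0 (u i) in β , λ _ → u≤bβ

        -- The left side of a row is a join, so its two terms are bounded separately. Where `b i`
        -- vanishes, the first eliminated family bounds `u i`; where `a i` vanishes, the term in `μ`
        -- is zero, the least element.
        bounds⇒solution : ∀ μ → (∀ i → b i ≉ 0# → u i ≤ v i + b i * μ) →
                          (∀ i → a i ≉ 0# → a i * μ ≤ v i) → Solution μ
        bounds⇒solution μ u≤v+bμ aμ≤v i = +-lub left right
          where
          left : u i ≤ v i + b i * μ
          left with b i ≟ 0#
          ... | yes bᵢ≈0 = ≤-trans (proj₁ elim i bᵢ≈0) (x≤x+y _ _)
          ... | no  bᵢ≉0 = u≤v+bμ i bᵢ≉0
          right : a i * μ ≤ v i + b i * μ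
          right with a i ≟ 0#
          ... | yes aᵢ≈0 =
            ≤-respˡ-≈ (sym (trans (*-congʳ aᵢ≈0) (zeroˡ μ))) (0#-minimum _)
          ... | no  aᵢ≉0 = ≤-trans (aμ≤v i aᵢ≉0) (x≤x+y _ _)

        eliminated⇒solution : ∃[ μ ] Solution μ
        eliminated⇒solution with argmin (λ k → a k ≟ 0#) bound
        -- No row bounds the unknown from above, so it may be the sum of the witnesses, which
        -- dominates each of them and so serves all rows at once.
        ... | inj₁ a≈0 = sum β , bounds⇒solution (sum β)
          (λ i bᵢ≉0 → begin
            u i                ≤⟨ proj₂ (witness i) bᵢ≉0 ⟩
            b i * β i          ≤⟨ *-monoʳ-≤ (b i) (lookup≤sum β i) ⟩
            b i * sum β        ≤⟨ y≤x+y _ _ ⟩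
            v i + b i * sum β  ∎)
          (λ i aᵢ≉0 → contradiction (a≈0 i) aᵢ≉0)
          where
          β : Vector Carrier p
          β = proj₁ ∘ witness
        ... | inj₂ (k , aₖ≉0 , min) = bound k aₖ≉0 , bounds⇒solution (bound k aₖ≉0)
          -- The inequality eliminated from rows `i` and `k` is, up to associativity, row `i` at the
          -- least bound.
          (λ i bᵢ≉0 → ≤-respʳ-≈ (+-congˡ (*-assoc _ _ _)) (proj₂ elim i k bᵢ≉0 aₖ≉0))
          (λ i aᵢ≉0 → ≤-respʳ-≈ (a*bound≈v i aᵢ≉0) (*-monoʳ-≤ (a i) (min i aᵢ≉0)))

theorem10 : ∀ {c ℓ₁ ℓ₂} (S : TotallyOrderedIdempotentSemiring c ℓ₁ ℓ₂) →
    let open TotallyOrderedIdempotentSemiring S in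
    (p m : ℕ) (A B : Matrix S p (suc m)) (c d : Vector Carrier p) →
    (inv : LastColumnInvertible S A) →
    (∀ i → B i (fromℕ m) ≉ 0# → ∀ α → ∃[ β ] (α ≤ B i (fromℕ m) * β)) →
    (∀ i j → A i j ≈ 0# ⊎ B i j ≈ 0#) →
    ∀ (x : Vector Carrier m) →
    EliminatedSet S A B c d inv x
    ⇔ (∃[ μ ] SolutionSet S A B c d (insertAt x (fromℕ m) μ))
theorem10 S p m A B c d inv unbounded disjoint x = mk⇔
  (λ (elim₁ , elim₂) →
    let μ , sol = eliminated⇒solution S a b u v inv disjointₙ unbounded
          (elim₁ , λ i k bᵢ≉0 aₖ≉0 → ≤-respʳ-≈ (combined i k _) (elim₂ i k bᵢ≉0 aₖ≉0))
    in μ , λ i → ≤-respˡ-≈ (sym (row A c i μ)) (≤-respʳ-≈ (sym (row B d i μ)) (sol i)))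
  (λ (μ , sol) →
    let elim₁ , elim₂ = solution⇒eliminated S a b u v inv disjointₙ
          (λ i → ≤-respˡ-≈ (row A c i μ) (≤-respʳ-≈ (row B d i μ) (sol i)))
    in elim₁ , λ i k bᵢ≉0 aₖ≉0 →
         ≤-respʳ-≈ (sym (combined i k _)) (elim₂ i k bᵢ≉0 aₖ≉0))
  where
  open TotallyOrderedIdempotentSemiring S
  open IsDecTotalOrder isDecTotalOrder using (≤-respˡ-≈; ≤-respʳ-≈)
  open Semiring semiring
    using (sym; trans; +-congˡ; +-congʳ; +-assoc; distribˡ; +-commutativeSemigroup)
  open import Algebra.Properties.CommutativeSemigroup +-commutativeSemigroup
    using (interchange; xy∙z≈xz∙y)

  n : Fin (suc m)
  n = fromℕ m

  a b u v : Vector Carrier p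
  a i = A i n
  b i = B i n
  u i = dot S (removeAt (A i) n) x + c i
  v i = dot S (removeAt (B i) n) x + d i

  disjointₙ : ∀ i → a i ≈ 0# ⊎ b i ≈ 0#
  disjointₙ i = disjoint i n

  row : ∀ (M : Matrix S p (suc m)) (e : Vector Carrier p) i μ →
        dot S (M i) (insertAt x n μ) + e i
          ≈ dot S (removeAt (M i) n) x + e i + M i n * μ
  row M e i μ = trans (+-congʳ (dot-insertAt S (M i) x n μ)) (xy∙z≈xz∙y _ _ _)

  -- Matches the right side of the theorem's second family with that of `Eliminated`: the row parts
  -- and the constants `d` are regrouped by row, and `t` is factored out of row `k`.
  combined : ∀ i k t →
             dot S (removeAt (λ j → B i j + t * B k j) n) x + d i + t * d k
               ≈ v i + t * v k
  combined i k t =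
    trans (+-congʳ (+-congʳ (dot-+-* S (removeAt (B i) n) (removeAt (B k) n) x t)))
    (trans (+-assoc _ _ _)
    (trans (interchange _ _ _ _)
      (+-congˡ (sym (distribˡ t _ (d k))))))
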